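{- Let $G$ be a graph. (1) If $G\in\mathcal G_{\{\mathcal A_i\}_{i=1}^m}$ for some collection of block partitions $\{\mathcal A_i\}_{i=1}^m$ with $\mathcal A_i=(A_{i,j})_{j=0}^{n_i-1}$, then $\mathcal C=\{C_i\}_{i=1}^m$ with $C_i=G[\{v_{i,j}\}_{j=0}^{n_i-1}]$ forms a chain set induced by a relaxed chronology of standard forces $\mathcal F$ acting on the standard zero forcing set $\{v_{i,0}\}_{i=1}^m$ of $G$. (2) $\operatorname{Z}(G)=\min\{m: G\in\mathcal G_{\{\mathcal A_i\}_{i=1}^m}\text{ for some collection of block partitions }\{\mathcal A_i\}_{i=1}^m\}$ (membership understood up to labeling the vertices of $G$).
   Context: All graphs are finite, simple and undirected; $\mathbb N$ contains $0$. Standard zero forcing: each vertex is blue or white; a blue vertex $u$ with exactly one white neighbor $v$ can force $v$ to become blue ($u\to v$). $B$ is a standard zero forcing set if, starting with exactly $B$ blue, repeated forcing turns all vertices blue; $\operatorname{Z}(G)$ is the minimum size of such a set. $S(G,B)$ is the set of forces valid when exactly $B$ is blue. Relaxed chronology of standard forces for a standard zero forcing set $B$: an ordered family $\mathcal F=\{F^{(k)}\}_{k=1}^K$ of sets of forces ($F^{(k)}=\emptyset$ allowed) such that, with $E^{[0]}=E^{(0)}=B$, $E^{(k)}=\{u: v\to u\in F^{(k)}\text{ for some }v\}$, $E^{[k]}=\bigcup_{j=0}^kE^{(j)}$: (1) $F^{(k)}\subseteq S(G,E^{[k-1]})$ for all $k$; (2) $v_1\to u,v_2\to u\in F^{(k)}$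 implies $v_1=v_2$; (3) $E^{[K]}=V(G)$. Its chain set is the collection of forcing chains $(v_0,\dots,v_\ell)$, one for each $v_0\in B$, with $v_{i-1}\to v_i\in\bigcup_kF^{(k)}$ and $v_\ell$ performing no force; each chain is identified with the induced path on its vertices. A block partition of $\{0,\dots,K\}$ ($K\in\mathbb N$) is a partition $(A_0,\dots,A_{n-1})$ of it into nonempty parts such that $j_1<j_2$ implies every element of $A_{j_1}$ is less than every element of $A_{j_2}$. Family $\mathcal G_{\{\mathcal A_i\}_{i=1}^m}$: given $K$ and block partitions $\mathcal A_i=(A_{i,j})_{j=0}^{n_i-1}$ of $\{0,\dots,K\}$ for $i=1,\dots,m$, let $V=\{v_{i,j}:1\le i\le m,0\le j\le n_i-1\}$, $E_1=\{v_{i,j_1}v_{i,j_2}:|j_1-j_2|=1\}$, $E_2=\{v_{i_1,j_1}v_{i_2,j_2}:i_1\ne i_2,\ A_{i_1,j_1}\cap A_{i_2,j_2}\neq\emptyset\}$. Then $\mathcal G_{\{\mathcal A_i\}_{i=1}^m}$ is the set of all graphs $(V,E_1\cup E)$ with $E\subseteq E_2$. -}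

module Defs where

open import Data.Fin using (Fin; zero; suc; toℕ; inject₁; fromℕ; _≤?_; _<_)
open import Data.Fin.Subset using (Subset; _∈_; _∉_; _∪_; _∩_; ⁅_⁆; ⋃; ⊤; ∣_∣; Nonempty)
open import Data.List using (tabulate; filter; map; allFin)
open import Data.Nat using (ℕ; suc; ∣_-_∣; _≤_)
open import Data.Product using (Σ-syntax; ∃-syntax; ∃!; _×_; _,_)
open import Data.Sum using (_⊎_)
open import Function using (_∘_)
open import Function.Bundles using (_⇔_; _↔_; Inverse)
open import Function.Definitions using (Injective)
open import Level using (0ℓ)
open import Relation.Binary using (Rel; Symmetric; Irreflexive; Decidable; _⇒_)
open import Relation.Binary.Construct.Closure.ReflexiveTransitive using (Star)
open import Relation.Binary.PropositionalEquality using (_≡_; _≢_)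
open import Relation.Nullary using (¬_)

-- Decidability of adjacency is what makes this a finite object constructively;
-- classically it is no restriction.
record Graph (n : ℕ) : Set₁ where
  field
    Adj    : Rel (Fin n) 0ℓ
    sym    : Symmetric Adj
    irrefl : Irreflexive _≡_ Adj
    adj?   : Decidable Adj

open Graph public using (Adj)

IsMinimum : ∀ {ℓ} → (ℕ → Set ℓ) → ℕ → Set ℓ
IsMinimum P z = P z × (∀ m → P m → z ≤ m)

｛_｝ : ∀ {k n} → (Fin k → Fin n) → Subset n
｛ f ｝ = ⋃ (tabulate (⁅_⁆ ∘ f))

-- The force u → v belongs to S(G,B).
record ValidForce {n} (G : Graph n) (B : Subset n) (u v : Fin n) : Set where
  field
    blue      : u ∈ B
    white     : v ∉ B
    adjacent  : Adj G u v
    onlyWhite : ∀ w → Adj G u w → w ∉ B → w ≡ v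

ForcingStep : ∀ {n} → Graph n → Rel (Subset n) 0ℓ
ForcingStep G B B′ = ∃[ u ] ∃[ v ] (ValidForce G B u v × B′ ≡ B ∪ ⁅ v ⁆)

IsZeroForcingSet : ∀ {n} → Graph n → Subset n → Set
IsZeroForcingSet G B = Star (ForcingStep G) B ⊤

-- "Z(G) = z".
IsZeroForcingNumber : ∀ {n} → Graph n → ℕ → Set
IsZeroForcingNumber G =
  IsMinimum (λ s → ∃[ B ] (IsZeroForcingSet G B × ∣ B ∣ ≡ s))

-- A set F of forces on n vertices; u → v belongs to F iff v ∈ F u.
ForceSet : ℕ → Set
ForceSet n = Fin n → Subset n

-- Indices are shifted: for k : Fin K, the value F k is the set F^(k+1).
-- E F B k is E^(k), for 0 ≤ k ≤ K.
E : ∀ {n K} → (Fin K → ForceSet n) → Subset n → Fin (suc K) → Subset n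
E F B zero    = B
E F B (suc k) = ⋃ (tabulate (F k))

-- E^[k], the union of the E^(j) with j ≤ k.
E[] : ∀ {n K} → (Fin K → ForceSet n) → Subset n → Fin (suc K) → Subset n
E[] {K = K} F B k = ⋃ (map (E F B) (filter (_≤? k) (allFin (suc K))))

record IsRelaxedChronology {n K} (G : Graph n) (B : Subset n)
                           (F : Fin K → ForceSet n) : Set where
  field
    valid        : ∀ k {u v} → v ∈ F k u → ValidForce G (E[] F B (inject₁ k)) u v
    uniqueForcer : ∀ k {v₁ v₂ u} → u ∈ F k v₁ → u ∈ F k v₂ → v₁ ≡ v₂
    allBlue      : E[] F B (fromℕ K) ≡ ⊤

-- The chain (v_0, …, v_ℓ) is  vertex : Fin (suc ℓ) → Fin n.
record IsForcingChain {n K} (B : Subset n) (F : Fin K → ForceSet n)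
                      {ℓ} (vertex : Fin (suc ℓ) → Fin n) : Set where
  field
    start  : vertex zero ∈ B
    forces : ∀ (i : Fin ℓ) → ∃[ k ] vertex (suc i) ∈ F k (vertex (inject₁ i))
    final  : ∀ k u → ¬ (u ∈ F k (vertex (fromℕ ℓ)))

-- The induced subgraph G[W] is the path on the distinct vertices p 0, p 1, …
-- taken in this order.
record IsInducedPath {n k} (G : Graph n) (W : Subset n) (p : Fin k → Fin n) : Set where
  field
    vertices : ｛ p ｝ ≡ W
    distinct : Injective _≡_ _≡_ p
    edges    : ∀ a b → Adj G (p a) (p b) ⇔ ∣ toℕ a - toℕ b ∣ ≡ 1

-- The induced subgraphs G[C 0], …, G[C (m-1)] form the chain set of F: each of
-- them is the induced path on a forcing chain, and there is exactly one of these
-- chains for each v₀ ∈ B.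
record IsChainSet {n K m} (G : Graph n) (B : Subset n) (F : Fin K → ForceSet n)
                  (C : Fin m → Subset n) : Set where
  field
    len     : Fin m → ℕ
    chain   : ∀ i → Fin (suc (len i)) → Fin n
    forcing : ∀ i → IsForcingChain B F (chain i)
    path    : ∀ i → IsInducedPath G (C i) (chain i)
    unique  : ∀ v₀ → v₀ ∈ B → ∃! _≡_ (λ i → chain i zero ≡ v₀)

-- A block partition of {0, …, K} = Fin (suc K). As this set is nonempty there is
-- at least one block, so the number of blocks is written suc last.
record BlockPartition (K : ℕ) : Set where
  field
    last     : ℕ
    block    : Fin (suc last) → Subset (suc K)
    nonempty : ∀ j → Nonempty (block j)
    covers   : ∀ x → ∃! _≡_ (λ j → x ∈ block j)
    ordered  : ∀ {j₁ j₂} → j₁ < j₂ → ∀ {x y} → x ∈ block j₁ → y ∈ block j₂ → x < y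

open BlockPartition public using (last; block)

module _ {K m : ℕ} (𝒜 : Fin m → BlockPartition K) where

  -- The vertex v_{i,j} is the pair (i , j).
  V : Set
  V = Σ[ i ∈ Fin m ] Fin (suc (last (𝒜 i)))

  E₁ : Rel V 0ℓ
  E₁ (i₁ , j₁) (i₂ , j₂) = i₁ ≡ i₂ × ∣ toℕ j₁ - toℕ j₂ ∣ ≡ 1

  E₂ : Rel V 0ℓ
  E₂ (i₁ , j₁) (i₂ , j₂) = i₁ ≢ i₂ × Nonempty (block (𝒜 i₁) j₁ ∩ block (𝒜 i₂) j₂)

  -- G belongs to the family of 𝒜 when the vertex of G named v_{i,j} is φ (i , j).
  -- Sets of undirected edges are symmetric relations.
  InFamily : ∀ {n} → Graph n → V ↔ Fin n → Set₁
  InFamily G φ =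
    Σ[ E′ ∈ Rel V 0ℓ ] (Symmetric E′ × (E′ ⇒ E₂) ×
      (∀ x y → Adj G (Inverse.to φ x) (Inverse.to φ y) ⇔ (E₁ x y ⊎ E′ x y)))

-- G belongs, up to labelling its vertices, to the family of some collection of
-- m block partitions.
InSomeFamily : ∀ {n} → Graph n → ℕ → Set₁
InSomeFamily {n} G m =
  ∃[ K ] Σ[ 𝒜 ∈ (Fin m → BlockPartition K) ] Σ[ φ ∈ (V 𝒜 ↔ Fin n) ] InFamily 𝒜 G φ

{-# OPTIONS --safe #-}
-- For (1), the force v_{i,j} → v_{i,j+1} happens at the time min A_{i,j+1}.  The
-- neighbours of v_{i,j} outside its chain share a time with it, so they are blue
-- by then.  For (2), give every vertex of a forcing process the set of times at
-- which it is the last blue vertex of its chain.  When u forces v, all blue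
-- neighbours of v still have a white neighbour, so they end their chains and
-- share the current time with v.
module Submission where

open import Defs
open import Data.Fin using (Fin; zero; suc; toℕ; inject₁; fromℕ; fromℕ<; _≟_; _≤_; _<_; _≤?_)
open import Data.Fin.Induction using (<-wellFounded; <-weakInduction)
open import Data.Fin.Properties using (any?; all?; toℕ-injective; toℕ-inject₁; toℕ-fromℕ<; toℕ<n;
  ≤fromℕ; ≤∧≢⇒<; <⇒≢; ≤-antisym; suc-injective)
open import Data.Fin.Subset using (Subset; _∈_; _∉_; _⊆_; _⊃_; _∪_; ⁅_⁆; ⋃; ⊤; ∣_∣; inside; outside)
open import Data.Fin.Subset.Induction using (⊃-wellFounded)
open import Data.Fin.Subset.Properties using (_∈?_; _⊆?_; anySubset?; x∈⁅x⁆; x∈⁅y⁆⇒x≡y; x∈p∪q⁺; x∈p∪q⁻;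
  x∈p∩q⁺; x∈p∩q⁻; p⊆p∪q; ∉⊥; ∈⊤; ⊆-antisym; ⊆-max; ∣⊤∣≡n; ∣⊥∣≡0; ∣⁅x⁆∣≡1)
open import Data.List using ([]; _∷_; tabulate; filter; map; allFin)
open import Data.List.Membership.Propositional using (find; lose)
open import Data.List.Membership.Propositional.Properties using (∈-filter⁺; ∈-filter⁻; ∈-allFin)
open import Data.List.Relation.Unary.Any using (Any; here; there)
import Data.List.Relation.Unary.Any.Properties as Any
open import Data.Nat as ℕ using (ℕ; zero; suc; _+_; ∣_-_∣; z≤n; s≤s)
import Data.Nat.Induction as ℕ
import Data.Nat.Properties as ℕ
open import Data.Product using (Σ-syntax; ∃-syntax; ∃; ∃₂; ∃!; _×_; _,_; proj₁; proj₂)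
open import Data.Sum using (_⊎_; inj₁; inj₂)
import Data.Vec as Vec
open import Data.Vec using ([]; _∷_; here; there)
open import Data.Vec.Properties using ([]=⇒lookup; lookup⇒[]=; lookup∘tabulate)
open import Function using (_∘_; _$_)
open import Function.Bundles using (_⇔_; _↔_; Inverse; Injection; Equivalence; mk⇔; mk⤖)
open import Function.Definitions using (Injective)
open import Function.Properties.Bijection using (⤖⇒↔)
open import Function.Properties.Inverse using (↔⇒↣)
open import Induction.WellFounded using (Acc; acc)
open import Relation.Binary.Construct.Closure.ReflexiveTransitive using (Star; ε; _◅_)
open import Relation.Binary.PropositionalEquality using (_≡_; _≢_; refl; sym; trans; cong; subst; ≢-sym)
open import Relation.Nullary using (¬_; Dec; yes; no; does; proof; contradiction)
open import Relation.Nullary.Decidable using (_×-dec_; _→-dec_; ¬?; map′; dec-true)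
open import Relation.Nullary.Reflects using (Reflects; invert)
open import Relation.Unary using (Decidable; Pred)

open Equivalence using (to; from)

private variable
  n k K m l : ℕ

-- Distances, minima and comparison of times

∣m-n∣≡1⇒ : ∀ a b → ∣ a - b ∣ ≡ 1 → b ≡ suc a ⊎ a ≡ suc b
∣m-n∣≡1⇒ zero    b       eq = inj₁ eq
∣m-n∣≡1⇒ (suc a) zero    eq = inj₂ eq
∣m-n∣≡1⇒ (suc a) (suc b) eq with ∣m-n∣≡1⇒ a b eq
... | inj₁ p = inj₁ (cong suc p)
... | inj₂ p = inj₂ (cong suc p)

∣m-1+m∣≡1 : ∀ a → ∣ a - suc a ∣ ≡ 1
∣m-1+m∣≡1 zero    = refl
∣m-1+m∣≡1 (suc a) = ∣m-1+m∣≡1 a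

-- Starts from the witness and descends: decidability allows a bounded search for a smaller one, and
-- well-foundedness of `<` ends the descent.
minimum : ∀ {p} {P : ℕ → Set p} → Decidable P → ∃ P → ∃ (IsMinimum P)
minimum {P = P} P? (s , Ps) = search s (ℕ.<-wellFounded s) Ps
  where
  search : ∀ s → Acc ℕ._<_ s → P s → ∃ (IsMinimum P)
  search s (acc rec) Ps with ℕ.anyUpTo? P? s
  ... | yes (r , r<s , Pr) = search r (rec r<s) Pr
  ... | no none = s , Ps , λ r Pr → ℕ.≮⇒≥ λ r<s → none (r , r<s , Pr)

≤inject₁⊎suc≤ : (x : Fin (suc K)) (k : Fin K) → x ≤ inject₁ k ⊎ suc k ≤ x
≤inject₁⊎suc≤ x k with ℕ.≤-<-connex (toℕ x) (toℕ k)
... | inj₁ x≤k = inj₁ (subst (toℕ x ℕ.≤_) (sym (toℕ-inject₁ k)) x≤k)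
... | inj₂ k<x = inj₂ k<x

inject₁≤suc : (k : Fin K) → inject₁ k ≤ suc k
inject₁≤suc k = ℕ.≤-trans (ℕ.≤-reflexive (toℕ-inject₁ k)) (ℕ.n≤1+n (toℕ k))

-- Finite subsets

comprehension : ∀ {p} {P : Pred (Fin n) p} → Decidable P → Subset n
comprehension P? = Vec.tabulate (does ∘ P?)

module _ {p} {P : Pred (Fin n) p} (P? : Decidable P) where

  ∈-comprehension⁺ : ∀ {x} → P x → x ∈ comprehension P?
  ∈-comprehension⁺ {x} px =
    lookup⇒[]= x _ (trans (lookup∘tabulate (does ∘ P?) x) (dec-true (P? x) px))

  ∈-comprehension⁻ : ∀ {x} → x ∈ comprehension P? → P x
  ∈-comprehension⁻ {x} x∈ = invert (subst (Reflects (P x)) does≡true (proof (P? x)))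
    where does≡true = trans (sym (lookup∘tabulate (does ∘ P?) x)) ([]=⇒lookup x∈)

∈-⋃⁺ : ∀ {x : Fin n} {ps} → Any (x ∈_) ps → x ∈ ⋃ ps
∈-⋃⁺ (here x∈p)   = x∈p∪q⁺ (inj₁ x∈p)
∈-⋃⁺ (there x∈ps) = x∈p∪q⁺ (inj₂ (∈-⋃⁺ x∈ps))

∈-⋃⁻ : ∀ {x : Fin n} ps → x ∈ ⋃ ps → Any (x ∈_) ps
∈-⋃⁻ []       x∈ = contradiction x∈ ∉⊥
∈-⋃⁻ (p ∷ ps) x∈ with x∈p∪q⁻ p (⋃ ps) x∈
... | inj₁ x∈p  = here x∈p
... | inj₂ x∈ps = there (∈-⋃⁻ ps x∈ps)

∈-image⁺ : (f : Fin k → Fin n) (i : Fin k) → f i ∈ ｛ f ｝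
∈-image⁺ f i = ∈-⋃⁺ (Any.tabulate⁺ i (x∈⁅x⁆ (f i)))

∈-image⁻ : ∀ (f : Fin k → Fin n) {x} → x ∈ ｛ f ｝ → ∃[ i ] f i ≡ x
∈-image⁻ f x∈ with Any.tabulate⁻ (∈-⋃⁻ _ x∈)
... | i , x∈i = i , sym (x∈⁅y⁆⇒x≡y (f i) x∈i)

∣p∪q∣≤∣p∣+∣q∣ : (p q : Subset n) → ∣ p ∪ q ∣ ℕ.≤ ∣ p ∣ + ∣ q ∣
∣p∪q∣≤∣p∣+∣q∣ []            []            = z≤n
∣p∪q∣≤∣p∣+∣q∣ (outside ∷ p) (outside ∷ q) = ∣p∪q∣≤∣p∣+∣q∣ p q
∣p∪q∣≤∣p∣+∣q∣ (outside ∷ p) (inside  ∷ q) =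
  ℕ.≤-trans (s≤s (∣p∪q∣≤∣p∣+∣q∣ p q)) (ℕ.≤-reflexive (sym (ℕ.+-suc _ _)))
∣p∪q∣≤∣p∣+∣q∣ (inside  ∷ p) (outside ∷ q) = s≤s (∣p∪q∣≤∣p∣+∣q∣ p q)
∣p∪q∣≤∣p∣+∣q∣ (inside  ∷ p) (inside  ∷ q) =
  s≤s (ℕ.≤-trans (∣p∪q∣≤∣p∣+∣q∣ p q) (ℕ.+-monoʳ-≤ ∣ p ∣ (ℕ.n≤1+n _)))

-- Bounds the size of the set of chain starts by the number of chains.
∣image∣≤ : (f : Fin k → Fin n) → ∣ ｛ f ｝ ∣ ℕ.≤ k
∣image∣≤ {k = zero}  {n} f = ℕ.≤-reflexive (∣⊥∣≡0 n)
∣image∣≤ {k = suc k} {n} f = begin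
  ∣ ⁅ f zero ⁆ ∪ ｛ f ∘ suc ｝ ∣      ≤⟨ ∣p∪q∣≤∣p∣+∣q∣ ⁅ f zero ⁆ _ ⟩
  ∣ ⁅ f zero ⁆ ∣ + ∣ ｛ f ∘ suc ｝ ∣  ≡⟨ cong (_+ ∣ ｛ f ∘ suc ｝ ∣) (∣⁅x⁆∣≡1 (f zero)) ⟩
  suc ∣ ｛ f ∘ suc ｝ ∣               ≤⟨ s≤s (∣image∣≤ (f ∘ suc)) ⟩
  suc k                              ∎
  where open ℕ.≤-Reasoning

-- Labels the chains that start in `B`, so that a zero forcing set of size `s` gives exactly `s`
-- chains.
enumerate : (B : Subset n) → Fin ∣ B ∣ → Fin n
enumerate (inside  ∷ B) zero    = zero
enumerate (inside  ∷ B) (suc i) = suc (enumerate B i)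
enumerate (outside ∷ B) i       = suc (enumerate B i)

enumerate-∈ : (B : Subset n) (i : Fin ∣ B ∣) → enumerate B i ∈ B
enumerate-∈ (inside  ∷ B) zero    = here
enumerate-∈ (inside  ∷ B) (suc i) = there (enumerate-∈ B i)
enumerate-∈ (outside ∷ B) i       = there (enumerate-∈ B i)

enumerate-injective : (B : Subset n) → Injective _≡_ _≡_ (enumerate B)
enumerate-injective (inside  ∷ B) {zero}  {zero}  eq = refl
enumerate-injective (inside  ∷ B) {suc i} {suc j} eq =
  cong suc (enumerate-injective B (suc-injective eq))
enumerate-injective (outside ∷ B) eq = enumerate-injective B (suc-injective eq)

enumerate-surjective : (B : Subset n) → ∀ {u} → u ∈ B → ∃[ i ] enumerate B i ≡ u
enumerate-surjective (inside  ∷ B) here = zero , refl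
enumerate-surjective (inside  ∷ B) (there u∈B) with enumerate-surjective B u∈B
... | i , refl = suc i , refl
enumerate-surjective (outside ∷ B) (there u∈B) with enumerate-surjective B u∈B
... | i , refl = i , refl

-- Zero forcing and relaxed chronologies

module _ (G : Graph n) where

  open ValidForce

  -- Stuck supersets of `B` bound everything that can be forced from `B`. Arguing with them avoids
  -- any choice of an order of the forces.
  Stuck : Subset n → Set
  Stuck B = ∀ u v → ¬ ValidForce G B u v

  validForce? : ∀ B u v → Dec (ValidForce G B u v)
  validForce? B u v = map′
    (λ (b , w , a , o) → record { blue = b ; white = w ; adjacent = a ; onlyWhite = o })
    (λ f → blue f , white f , adjacent f , onlyWhite f)
    (u ∈? B ×-dec ¬? (v ∈? B) ×-dec adj? u v ×-dec
      all? (λ w → adj? u w →-dec (¬? (w ∈? B) →-dec w ≟ v)))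
    where open Graph G using (adj?)

  -- Enlarging the blue set only removes white neighbours of `u`, so the force survives while its
  -- target stays white.
  validForce-mono : ∀ {B B′ u v} → B ⊆ B′ → v ∉ B′ → ValidForce G B u v → ValidForce G B′ u v
  validForce-mono B⊆B′ v∉B′ f = record
    { blue      = B⊆B′ (blue f)
    ; white     = v∉B′
    ; adjacent  = adjacent f
    ; onlyWhite = λ w u~w w∉B′ → onlyWhite f w u~w (w∉B′ ∘ B⊆B′)
    }

  force-stuck : ∀ {B S u v} → B ⊆ S → Stuck S → ValidForce G B u v → v ∈ S
  force-stuck {S = S} {v = v} B⊆S stuck f with v ∈? S
  ... | yes v∈S = v∈S
  ... | no  v∉S = contradiction (validForce-mono B⊆S v∉S f) (stuck _ _)

  forcing-stuck : ∀ {B B′ S} → Star (ForcingStep G) B B′ → B ⊆ S → Stuck S → B′ ⊆ S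
  forcing-stuck ε B⊆S stuck = B⊆S
  forcing-stuck {B} {S = S} ((u , v , f , refl) ◅ steps) B⊆S stuck =
    forcing-stuck steps B∪v⊆S stuck
    where
    B∪v⊆S : B ∪ ⁅ v ⁆ ⊆ S
    B∪v⊆S x∈ with x∈p∪q⁻ B ⁅ v ⁆ x∈
    ... | inj₁ x∈B = B⊆S x∈B
    ... | inj₂ x∈v = subst (_∈ S) (sym (x∈⁅y⁆⇒x≡y v x∈v)) (force-stuck B⊆S stuck f)

  -- Greedy forcing terminates because every force strictly enlarges the blue set.
  closure : ∀ B → ∃[ S ] (Star (ForcingStep G) B S × Stuck S)
  closure B = go B (⊃-wellFounded B)
    where
    go : ∀ B → Acc _⊃_ B → ∃[ S ] (Star (ForcingStep G) B S × Stuck S)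
    go B (acc rec) with any? (λ u → any? (validForce? B u))
    ... | no none = B , ε , λ u v f → none (u , v , f)
    ... | yes (u , v , f) =
      let S , steps , stuck = go (B ∪ ⁅ v ⁆) (rec (p⊆p∪q ⁅ v ⁆ , v , x∈p∪q⁺ (inj₂ (x∈⁅x⁆ v)) , white f))
      in S , (u , v , f , refl) ◅ steps , stuck

  forcing-⊆ : ∀ {B B′} → Star (ForcingStep G) B B′ → B ⊆ B′
  forcing-⊆ ε                            = λ x∈ → x∈
  forcing-⊆ ((u , v , f , refl) ◅ steps) = forcing-⊆ steps ∘ p⊆p∪q ⁅ v ⁆

  -- The hypothesis is applied to the closure of `B`, which is itself a stuck superset.
  stuck⇒zeroForcing : ∀ {B} → (∀ {S} → B ⊆ S → Stuck S → ⊤ ⊆ S) → IsZeroForcingSet G B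
  stuck⇒zeroForcing {B} all-blue with closure B
  ... | S , steps , stuck =
    subst (Star _ B) (⊆-antisym (⊆-max S) (all-blue (forcing-⊆ steps) stuck)) steps

  -- It suffices to test whether one closure is everything: by `forcing-stuck`, no other sequence of
  -- forces leaves it.
  zeroForcing? : Decidable (IsZeroForcingSet G)
  zeroForcing? B with closure B
  ... | S , steps , stuck = map′ forcing ⊤⊆S (⊤ ⊆? S)
    where
    forcing : ⊤ ⊆ S → IsZeroForcingSet G B
    forcing ⊤⊆S = subst (Star _ B) (⊆-antisym (⊆-max S) ⊤⊆S) steps

    ⊤⊆S : IsZeroForcingSet G B → ⊤ ⊆ S
    ⊤⊆S forces = forcing-stuck forces (forcing-⊆ steps) stuck

  zeroForcingNumber : ∃ (IsZeroForcingNumber G)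
  zeroForcingNumber = minimum
    (λ s → anySubset? (λ B → zeroForcing? B ×-dec ∣ B ∣ ℕ.≟ s))
    (n , ⊤ , ε , ∣⊤∣≡n n)

module _ (F : Fin K → ForceSet n) (B : Subset n) where

  ∈-E[]⁺ : ∀ {j k u} → j ≤ k → u ∈ E F B j → u ∈ E[] F B k
  ∈-E[]⁺ {j} {k} j≤k u∈ =
    ∈-⋃⁺ (Any.map⁺ (lose (∈-filter⁺ (_≤? k) (∈-allFin j) j≤k) u∈))

  ∈-E[]⁻ : ∀ {k u} → u ∈ E[] F B k → ∃[ j ] (j ≤ k × u ∈ E F B j)
  ∈-E[]⁻ {k} u∈ with find (Any.map⁻ (∈-⋃⁻ (map (E F B) (filter (_≤? k) (allFin (suc K)))) u∈))
  ... | j , j∈ , u∈E = j , proj₂ (∈-filter⁻ (_≤? k) {xs = allFin (suc K)} j∈) , u∈E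

  E[]-mono : ∀ {j k} → j ≤ k → E[] F B j ⊆ E[] F B k
  E[]-mono j≤k u∈ with ∈-E[]⁻ u∈
  ... | i , i≤j , u∈E = ∈-E[]⁺ (ℕ.≤-trans i≤j j≤k) u∈E

-- Induction on time puts each `E F B x` inside every stuck superset `S` of `B`: the forces of step
-- `k` are valid for a blue set already contained in `S`, so their targets lie in `S`. Simultaneous
-- forces need no sequencing.
chronology⇒zeroForcing : ∀ {G : Graph n} {B} {F : Fin K → ForceSet n} →
                         IsRelaxedChronology G B F → IsZeroForcingSet G B
chronology⇒zeroForcing {K = K} {G} {B} {F} chronology = stuck⇒zeroForcing G all-blue
  where
  open IsRelaxedChronology chronology
  module _ {S} (B⊆S : B ⊆ S) (stuck : Stuck G S) where
    E⊆S : ∀ x → Acc _<_ x → E F B x ⊆ S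
    E⊆S zero    _         u∈ = B⊆S u∈
    E⊆S (suc k) (acc rec) u∈ with Any.tabulate⁻ (∈-⋃⁻ (tabulate (F k)) u∈)
    ... | u , v∈ = force-stuck G E[]⊆S stuck (valid k v∈)
      where
      E[]⊆S : E[] F B (inject₁ k) ⊆ S
      E[]⊆S w∈ with ∈-E[]⁻ F B w∈
      ... | j , j≤k , w∈E =
        E⊆S j (rec (s≤s (ℕ.≤-trans j≤k (ℕ.≤-reflexive (toℕ-inject₁ k))))) w∈E

    all-blue : ⊤ ⊆ S
    all-blue u∈ with ∈-E[]⁻ F B (subst (_ ∈_) (sym allBlue) u∈)
    ... | j , _ , u∈E = E⊆S j (<-wellFounded j) u∈E

-- Block partitions as monotone surjections

-- A block partition seen through the map from a time to the number of its block: `mono` expresses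
-- the order of the blocks, `surjective` that they are nonempty.
record MonotoneSurjection (K l : ℕ) : Set where
  field
    index      : Fin (suc K) → Fin (suc l)
    mono       : ∀ {x y} → x ≤ y → index x ≤ index y
    surjective : ∀ j → ∃[ x ] index x ≡ j

  index-zero : index zero ≡ zero
  index-zero with surjective zero
  ... | x , eq = ≤-antisym (ℕ.≤-trans (mono {zero} {x} z≤n) (ℕ.≤-reflexive (cong toℕ eq))) z≤n

  -- A skipped value would have no preimage: times up to `inject₁ k` have a smaller index, later
  -- times a larger one.
  index-suc : ∀ k → index (inject₁ k) ≢ index (suc k) →
              toℕ (index (suc k)) ≡ suc (toℕ (index (inject₁ k)))
  index-suc k moved = ℕ.≤-antisym (ℕ.≮⇒≥ no-gap) (≤∧≢⇒< (mono (inject₁≤suc k)) moved)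
    where
    no-gap : ¬ (suc (toℕ (index (inject₁ k))) ℕ.< toℕ (index (suc k)))
    no-gap gap with ℕ.<-trans gap (toℕ<n (index (suc k)))
    ... | in-range with surjective (fromℕ< in-range)
    ... | x , eq with trans (cong toℕ eq) (toℕ-fromℕ< in-range) | ≤inject₁⊎suc≤ x k
    ... | eq′ | inj₁ x≤k = ℕ.1+n≰n (ℕ.≤-trans (ℕ.≤-reflexive (sym eq′)) (mono x≤k))
    ... | eq′ | inj₂ k<x = ℕ.<⇒≱ gap (ℕ.≤-trans (mono k<x) (ℕ.≤-reflexive eq′))

  -- Going back in time from a point of index `suc t`, the index must drop below `suc t` somewhere,
  -- as it is zero at time zero. By `index-suc` the jump there has size one, which fixes both
  -- values.
  transition : ∀ t → ∃[ k ] (index (inject₁ k) ≡ inject₁ t × index (suc k) ≡ suc t)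
  transition t with surjective (suc t)
  ... | x , eq = <-weakInduction
    (λ x → suc t ≤ index x → ∃[ k ] (index (inject₁ k) ≡ inject₁ t × index (suc k) ≡ suc t))
    (λ t<index → contradiction (subst (suc t ≤_) index-zero t<index) λ ())
    step x (ℕ.≤-reflexive (cong toℕ (sym eq)))
    where
    step : ∀ k → (suc t ≤ index (inject₁ k) → _) → suc t ≤ index (suc k) →
           ∃[ k ] (index (inject₁ k) ≡ inject₁ t × index (suc k) ≡ suc t)
    step k rec t<index with ≤inject₁⊎suc≤ (index (inject₁ k)) t
    ... | inj₂ t<index′ = rec t<index′
    ... | inj₁ index≤t =
      k , toℕ-injective (ℕ.≤-antisym index≤t
            (ℕ.≤-trans (ℕ.≤-reflexive (toℕ-inject₁ t))
              (ℕ.s≤s⁻¹ (ℕ.≤-trans t<index (ℕ.≤-reflexive next)))))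
        , toℕ-injective (ℕ.≤-antisym
            (ℕ.≤-trans (ℕ.≤-reflexive next) (s≤s (ℕ.≤-trans index≤t (ℕ.≤-reflexive (toℕ-inject₁ t)))))
            t<index)
      where
      next : toℕ (index (suc k)) ≡ suc (toℕ (index (inject₁ k)))
      next = index-suc k λ same → ℕ.<⇒≱ t<index
        (subst (ℕ._≤ toℕ t) (cong toℕ same)
          (subst (toℕ (index (inject₁ k)) ℕ.≤_) (toℕ-inject₁ t) index≤t))

module _ (P : BlockPartition K) where

  open BlockPartition P hiding (last; block)

  blockIndex : MonotoneSurjection K (last P)
  blockIndex = record
    { index      = λ x → proj₁ (covers x)
    ; mono       = λ {x} {y} x≤y → ℕ.≮⇒≥ λ y<x →
        ℕ.<⇒≱ (ordered y<x (proj₁ (proj₂ (covers y))) (proj₁ (proj₂ (covers x)))) x≤y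
    ; surjective = λ j → let x , x∈j = nonempty j in x , proj₂ (proj₂ (covers x)) x∈j
    }

  ∈-block⇒index : ∀ {x j} → x ∈ block P j → MonotoneSurjection.index blockIndex x ≡ j
  ∈-block⇒index {x} = proj₂ (proj₂ (covers x))

module _ (σ : MonotoneSurjection K l) where

  open MonotoneSurjection σ

  -- Turns the times recorded along a forcing process back into a block partition.
  fibres : BlockPartition K
  fibres = record
    { last     = l
    ; block    = λ j → comprehension (λ x → index x ≟ j)
    ; nonempty = λ j → let x , eq = surjective j in x , ∈-comprehension⁺ (λ x → index x ≟ j) eq
    ; covers   = λ x → index x , ∈-comprehension⁺ (λ y → index y ≟ index x) refl ,
                   λ {j} → ∈-comprehension⁻ (λ y → index y ≟ j)
    ; ordered  = λ {j₁} {j₂} j₁<j₂ {x} {y} x∈ y∈ → ℕ.≰⇒> λ y≤x → ℕ.<⇒≱ j₁<j₂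
        (subst (_≤ j₁) (∈-comprehension⁻ (λ y → index y ≟ j₂) y∈)
          (subst (index y ≤_) (∈-comprehension⁻ (λ y → index y ≟ j₁) x∈) (mono y≤x)))
    }

-- The chronology of a member of a family

module FamilyMember (G : Graph n) (𝒜 : Fin m → BlockPartition K) (φ : V 𝒜 ↔ Fin n)
                    (G∈ : InFamily 𝒜 G φ) where

  open module Time i = MonotoneSurjection (blockIndex (𝒜 i))

  v : ∀ i → Fin (suc (last (𝒜 i))) → Fin n
  v i j = Inverse.to φ (i , j)

  B : Subset n
  B = ｛ (λ i → v i zero) ｝

  -- The transport is forced by the type of `j`, which depends on the chain `i`.
  v-injective : ∀ {i i′ j j′} → v i j ≡ v i′ j′ →
                Σ[ e ∈ i ≡ i′ ] subst (λ i → Fin (suc (last (𝒜 i)))) e j ≡ j′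
  v-injective eq with Injection.injective (↔⇒↣ φ) eq
  ... | refl = refl , refl

  -- The end of chain i after the forces of time x.
  current : Fin m → Fin (suc K) → Fin n
  current i x = v i (index i x)

  -- The condition `u ≢ w` leaves out the chains whose end stays put at step `k`.
  Forced : Fin K → Fin n → Fin n → Set
  Forced k u w = ∃[ i ] (current i (inject₁ k) ≡ u × current i (suc k) ≡ w × u ≢ w)

  forced? : ∀ k u w → Dec (Forced k u w)
  forced? k u w = any? λ i → current i (inject₁ k) ≟ u ×-dec current i (suc k) ≟ w ×-dec ¬? (u ≟ w)

  F : Fin K → ForceSet n
  F k u = comprehension (forced? k u)

  ∈-F⁻ : ∀ k {u w} → w ∈ F k u → Forced k u w
  ∈-F⁻ k {u} = ∈-comprehension⁻ (forced? k u)

  ∈-E⁻ : ∀ x {u} → u ∈ E F B x → ∃[ i ] current i x ≡ u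
  ∈-E⁻ zero u∈ with ∈-image⁻ (λ i → v i zero) u∈
  ... | i , refl = i , cong (v i) (index-zero i)
  ∈-E⁻ (suc k) u∈ with Any.tabulate⁻ (∈-⋃⁻ (tabulate (F k)) u∈)
  ... | _ , u∈F with ∈-F⁻ k u∈F
  ... | i , _ , eq , _ = i , eq

  -- Induction on time: an end that does not move was blue before, and one that moves has just been
  -- forced.
  current-∈ : ∀ i x → current i x ∈ E[] F B x
  current-∈ i = <-weakInduction (λ x → current i x ∈ E[] F B x) start step
    where
    start : current i zero ∈ E[] F B zero
    start = ∈-E[]⁺ F B {zero} {zero} z≤n
      (subst (_∈ B) (cong (v i) (sym (index-zero i))) (∈-image⁺ (λ i → v i zero) i))

    step : ∀ k → current i (inject₁ k) ∈ E[] F B (inject₁ k) → current i (suc k) ∈ E[] F B (suc k)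
    step k rec with current i (inject₁ k) ≟ current i (suc k)
    ... | yes same = subst (_∈ E[] F B (suc k)) same (E[]-mono F B (inject₁≤suc k) rec)
    ... | no moved = ∈-E[]⁺ F B {suc k} {suc k} ℕ.≤-refl
      (∈-⋃⁺ (Any.tabulate⁺ (current i (inject₁ k))
        (∈-comprehension⁺ (forced? k (current i (inject₁ k))) (i , refl , refl , moved))))

  current-≤-∈ : ∀ i {x y} → y ≤ x → current i y ∈ E[] F B x
  current-≤-∈ i {x} {y} y≤x = E[]-mono F B y≤x (current-∈ i y)

  v-≤-∈ : ∀ i {j x} → j ≤ index i x → v i j ∈ E[] F B x
  v-≤-∈ i {j} {x} j≤ with surjective i j
  ... | y , refl with ℕ.≤-total (toℕ y) (toℕ x)
  ... | inj₁ y≤x = current-≤-∈ i y≤x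
  -- A time `y` of block `j` after `x` must have the same index as `x`, so the vertex is the end of
  -- the chain at `x`.
  ... | inj₂ x≤y = subst (λ j → v i j ∈ E[] F B x) (≤-antisym (mono i x≤y) j≤) (current-∈ i x)

  adjacency : ∀ x y → Adj G (Inverse.to φ x) (Inverse.to φ y) ⇔ (E₁ 𝒜 x y ⊎ proj₁ G∈ x y)
  adjacency = proj₂ (proj₂ (proj₂ G∈))

  E′⇒E₂ : ∀ {x y} → proj₁ G∈ x y → E₂ 𝒜 x y
  E′⇒E₂ = proj₁ (proj₂ (proj₂ G∈))

  consecutive : ∀ i k → current i (inject₁ k) ≢ current i (suc k) →
                toℕ (index i (suc k)) ≡ suc (toℕ (index i (inject₁ k)))
  consecutive i k moved = index-suc i k (moved ∘ cong (v i))

  -- A blue vertex is the end of its chain at some time up to `inject₁ k`, where the index is still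
  -- below the index of the target.
  white : ∀ i k → current i (inject₁ k) ≢ current i (suc k) → current i (suc k) ∉ E[] F B (inject₁ k)
  white i k moved u∈ with ∈-E[]⁻ F B u∈
  ... | y , y≤k , u∈E with ∈-E⁻ y u∈E
  ... | i′ , eq with v-injective eq
  ... | refl , eq′ = ℕ.<⇒≱ (ℕ.≤-reflexive (sym (consecutive i k moved)))
    (ℕ.≤-trans (ℕ.≤-reflexive (cong toℕ (sym eq′))) (mono i y≤k))

  -- Inside the chain, the predecessor is already blue and the successor is the target. A neighbour
  -- in another chain shares a time `x` with the forcing vertex, and `x` cannot come after step `k`
  -- because chain `i` then has moved on; hence the neighbour is blue.
  neighbour : ∀ i k → current i (inject₁ k) ≢ current i (suc k) → ∀ i′ j →
              Adj G (current i (inject₁ k)) (v i′ j) → v i′ j ∉ E[] F B (inject₁ k) →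
              v i′ j ≡ current i (suc k)
  neighbour i k moved i′ j u~w w∉ with to (adjacency _ _) u~w
  ... | inj₁ (refl , dist) with ∣m-n∣≡1⇒ (toℕ (index i (inject₁ k))) (toℕ j) dist
  ...   | inj₁ next = cong (v i) (toℕ-injective (trans next (sym (consecutive i k moved))))
  ...   | inj₂ prev = contradiction
    (v-≤-∈ i (ℕ.≤-trans (ℕ.n≤1+n _) (ℕ.≤-reflexive (sym prev)))) w∉
  neighbour i k moved i′ j u~w w∉ | inj₂ e with E′⇒E₂ e
  ... | _ , x , x∈ with x∈p∩q⁻ _ _ x∈
  ... | x∈i , x∈i′ with ∈-block⇒index (𝒜 i) x∈i | ∈-block⇒index (𝒜 i′) x∈i′ | ≤inject₁⊎suc≤ x k
  ... | _  | refl | inj₁ x≤k = contradiction (current-≤-∈ i′ x≤k) w∉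
  ... | eq | _    | inj₂ k<x = contradiction
    (ℕ.≤-trans (mono i k<x) (ℕ.≤-reflexive (cong toℕ eq)))
    (ℕ.<⇒≱ (ℕ.≤-reflexive (sym (consecutive i k moved))))

  chronology : IsRelaxedChronology G B F
  chronology = record
    { valid        = valid
    ; uniqueForcer = uniqueForcer
    ; allBlue      = ⊆-antisym (⊆-max _) λ {u} _ → all-blue u
    }
    where
    valid : ∀ k {u w} → w ∈ F k u → ValidForce G (E[] F B (inject₁ k)) u w
    valid k w∈ with ∈-F⁻ k w∈
    ... | i , refl , refl , moved = record
      { blue      = current-∈ i (inject₁ k)
      ; white     = white i k moved
      ; adjacent  = from (adjacency _ _) $ inj₁ $ refl ,
          subst (λ b → ∣ toℕ (index i (inject₁ k)) - b ∣ ≡ 1) (sym (consecutive i k moved))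
            (∣m-1+m∣≡1 (toℕ (index i (inject₁ k))))
      ; onlyWhite = λ w → onlyWhite (Inverse.from φ w) w (Inverse.strictlyInverseˡ φ w)
      }
      where
      onlyWhite : ∀ p w → Inverse.to φ p ≡ w → Adj G (current i (inject₁ k)) w →
                  w ∉ E[] F B (inject₁ k) → w ≡ current i (suc k)
      onlyWhite (i′ , j) _ refl = neighbour i k moved i′ j

    uniqueForcer : ∀ k {v₁ v₂ u} → u ∈ F k v₁ → u ∈ F k v₂ → v₁ ≡ v₂
    uniqueForcer k u∈₁ u∈₂ with ∈-F⁻ k u∈₁ | ∈-F⁻ k u∈₂
    -- The target lies in a single chain, and the forcing vertex is the end of that chain before
    -- step `k`.
    ... | i₁ , refl , eq₁ , _ | i₂ , refl , eq₂ , _ with v-injective (trans eq₁ (sym eq₂))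
    ... | refl , _ = refl

    all-blue : ∀ u → u ∈ E[] F B (fromℕ K)
    all-blue u with Inverse.from φ u | Inverse.strictlyInverseˡ φ u
    ... | i , j | refl with surjective i j
    ... | x , refl = current-≤-∈ i (≤fromℕ x)

  chainSet : IsChainSet G B F (λ i → ｛ v i ｝)
  chainSet = record
    { len     = λ i → last (𝒜 i)
    ; chain   = v
    ; forcing = λ i → record
      { start  = ∈-image⁺ (λ i → v i zero) i
      ; forces = forces i
      ; final  = final i
      }
    ; path    = λ i → record
      { vertices = refl
      ; distinct = distinct i
      ; edges    = λ a b → mk⇔ (path-edge i a b ∘ to (adjacency _ _))
                               (λ d → from (adjacency _ _) (inj₁ (refl , d)))
      }
    ; unique  = unique
    }
    where
    distinct : ∀ i → Injective _≡_ _≡_ (v i)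
    distinct i eq with Injection.injective (↔⇒↣ φ) eq
    ... | refl = refl

    forces : ∀ i t → ∃[ k ] v i (suc t) ∈ F k (v i (inject₁ t))
    forces i t with transition i t
    ... | k , eq₁ , eq₂ = k , ∈-comprehension⁺ (forced? k _)
      (i , cong (v i) eq₁ , cong (v i) eq₂ ,
        λ eq → <⇒≢ (s≤s (ℕ.≤-reflexive (toℕ-inject₁ t))) (distinct i eq))

    final : ∀ i k u → ¬ (u ∈ F k (v i (fromℕ (last (𝒜 i)))))
    final i k u u∈ with ∈-F⁻ k u∈
    ... | i′ , eq , refl , moved with v-injective eq
    -- A force by the last vertex would raise the index beyond its greatest value.
    ... | refl , eq′ = ℕ.<⇒≱
      (ℕ.≤-reflexive (sym (consecutive i k (λ same → moved (trans (sym eq) same)))))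
      (subst (index i (suc k) ≤_) (sym eq′) (≤fromℕ _))

    path-edge : ∀ i a b → E₁ 𝒜 (i , a) (i , b) ⊎ proj₁ G∈ (i , a) (i , b) → ∣ toℕ a - toℕ b ∣ ≡ 1
    path-edge i a b (inj₁ (_ , d)) = d
    path-edge i a b (inj₂ e)       = contradiction refl (proj₁ (E′⇒E₂ e))

    unique : ∀ v₀ → v₀ ∈ B → ∃! _≡_ (λ i → v i zero ≡ v₀)
    unique v₀ v₀∈ with ∈-image⁻ (λ i → v i zero) v₀∈
    ... | i , refl = i , refl , λ {_} eq → proj₁ (v-injective (sym eq))

-- From zero forcing sets to families

-- Time runs backwards: time 0 is the present and block 0 of a chain belongs to its
-- latest vertex.  This is harmless since the families are closed under reversing
-- time together with all chains.
record TimedChain (n K : ℕ) : Set where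
  constructor timed
  field
    {len}  : ℕ
    time   : MonotoneSurjection K len
    vertex : Fin (suc len) → Fin n

  open MonotoneSurjection time public

-- The new present joins block zero, since the latest vertex remains the end of the chain.
stay : TimedChain n K → TimedChain n (suc K)
stay {K = K} (timed σ vertex) = timed σ′ vertex
  where
  open MonotoneSurjection σ

  index′ : Fin (suc (suc K)) → Fin _
  index′ zero    = zero
  index′ (suc x) = index x

  mono′ : ∀ {x y} → x ≤ y → index′ x ≤ index′ y
  mono′ {zero}          _         = z≤n
  mono′ {suc x} {suc y} (s≤s x≤y) = mono x≤y

  σ′ : MonotoneSurjection _ _
  σ′ = record
    { index      = index′
    ; mono       = mono′
    ; surjective = λ j → let x , eq = surjective j in suc x , eq
    }

-- The new present is a block of its own, belonging to `v`; all older blocks move up by one.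
grow : Fin n → TimedChain n K → TimedChain n (suc K)
grow {K = K} v (timed {l} σ vertex) = timed σ′ λ { zero → v ; (suc j) → vertex j }
  where
  open MonotoneSurjection σ

  index′ : Fin (suc (suc K)) → Fin (suc (suc l))
  index′ zero    = zero
  index′ (suc x) = suc (index x)

  mono′ : ∀ {x y} → x ≤ y → index′ x ≤ index′ y
  mono′ {zero}          _         = z≤n
  mono′ {suc x} {suc y} (s≤s x≤y) = s≤s (mono x≤y)

  σ′ : MonotoneSurjection _ _
  σ′ = record
    { index      = index′
    ; mono       = mono′
    ; surjective = λ { zero    → zero , refl
                     ; (suc j) → let x , eq = surjective j in suc x , cong suc eq }
    }

open TimedChain using (vertex; index)

-- Invariants of a forcing process and their preservation

module _ (G : Graph n) where

  open Graph G using () renaming (sym to Adj-sym; irrefl to Adj-irrefl)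
  open ValidForce

  -- The field `inactive` concerns every vertex except the latest: these have already forced, so
  -- only the end of a chain can have a white neighbour.
  record BlueChain (B : Subset n) (c : TimedChain n K) : Set where
    open TimedChain c using (len)
    field
      isBlue   : ∀ j → vertex c j ∈ B
      distinct : Injective _≡_ _≡_ (vertex c)
      edges    : ∀ a b → Adj G (vertex c a) (vertex c b) ⇔ ∣ toℕ a - toℕ b ∣ ≡ 1
      inactive : ∀ (j : Fin len) {w} → Adj G (vertex c (suc j)) w → w ∈ B

  -- The field `meet` is the overlap condition of `E₂`, stated through a common time `x`.
  record Compatible (c c′ : TimedChain n K) : Set where
    field
      apart : ∀ j j′ → vertex c j ≢ vertex c′ j′
      meet  : ∀ j j′ → Adj G (vertex c j) (vertex c′ j′) →
              ∃[ x ] (index c x ≡ j × index c′ x ≡ j′)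

  record Process (B : Subset n) (c : Fin m → TimedChain n K) : Set where
    field
      blue-chain : ∀ i → BlueChain B (c i)
      compatible : ∀ {i i′} → i ≢ i′ → Compatible (c i) (c i′)
      covers     : ∀ {u} → u ∈ B → ∃₂ λ i j → vertex (c i) j ≡ u

  open BlueChain
  open Compatible
  open Process

  Compatible-sym : ∀ {c c′ : TimedChain n K} → Compatible c c′ → Compatible c′ c
  Compatible-sym cc′ = record
    { apart = λ j j′ → ≢-sym (apart cc′ j′ j)
    ; meet  = λ j j′ u~w → let x , eq , eq′ = meet cc′ j′ j (Adj-sym u~w) in x , eq′ , eq
    }

  initial : (B : Subset n) → Fin ∣ B ∣ → TimedChain n 0
  initial B i = timed
    -- There is a single time at the start, so any two of the initial vertices share it.
    (record { index = λ x → x ; mono = λ x≤y → x≤y ; surjective = λ j → j , refl })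
    (λ _ → enumerate B i)

  initial-process : ∀ B → Process B (initial B)
  initial-process B = record
    { blue-chain = λ i → record
      { isBlue   = λ _ → enumerate-∈ B i
      ; distinct = λ { {zero} {zero} _ → refl }
      ; edges    = λ { zero zero → mk⇔ (λ u~u → contradiction u~u (Adj-irrefl refl)) λ () }
      ; inactive = λ ()
      }
    ; compatible = λ i≢i′ → record
      { apart = λ _ _ eq → i≢i′ (enumerate-injective B eq)
      ; meet  = λ { zero zero _ → zero , refl , refl }
      }
    ; covers     = λ u∈ → let i , eq = enumerate-surjective B u∈ in i , zero , eq
    }

  module _ {B : Subset n} {u v : Fin n} (f : ValidForce G B u v) where

    old : B ⊆ B ∪ ⁅ v ⁆
    old = p⊆p∪q ⁅ v ⁆

    new : v ∈ B ∪ ⁅ v ⁆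
    new = x∈p∪q⁺ (inj₂ (x∈⁅x⁆ v))

    stay-blue : ∀ {c : TimedChain n K} → BlueChain B c → BlueChain (B ∪ ⁅ v ⁆) (stay c)
    stay-blue b = record
      { isBlue   = λ j → old (isBlue b j)
      ; distinct = distinct b
      ; edges    = edges b
      ; inactive = λ j u~w → old (inactive b j u~w)
      }

    grow-blue : ∀ {c : TimedChain n K} → BlueChain B c → vertex c zero ≡ u →
                BlueChain (B ∪ ⁅ v ⁆) (grow v c)
    grow-blue {c = c} b refl = record
      { isBlue   = λ { zero → new ; (suc j) → old (isBlue b j) }
      ; distinct = distinct′
      ; edges    = edges′
      ; inactive = inactive′
      }
      where
      distinct′ : Injective _≡_ _≡_ (vertex (grow v c))
      distinct′ {zero}  {zero}  _  = refl
      distinct′ {zero}  {suc j} eq = contradiction (subst (_∈ B) (sym eq) (isBlue b j)) (white f)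
      distinct′ {suc i} {zero}  eq = contradiction (subst (_∈ B) eq (isBlue b i)) (white f)
      distinct′ {suc i} {suc j} eq = cong suc (distinct b eq)

      new-edge : ∀ j → Adj G v (vertex c j) ⇔ suc (toℕ j) ≡ 1
      new-edge zero    = mk⇔ (λ _ → refl) (λ _ → Adj-sym (adjacent f))
      -- An older vertex of the chain has no white neighbours, but `v` is still white before the
      -- force.
      new-edge (suc j) = mk⇔ (λ v~w → contradiction (inactive b j (Adj-sym v~w)) (white f)) λ ()

      edges′ : ∀ i j → Adj G (vertex (grow v c) i) (vertex (grow v c) j) ⇔ ∣ toℕ i - toℕ j ∣ ≡ 1
      edges′ zero    zero    = mk⇔ (λ v~v → contradiction v~v (Adj-irrefl refl)) λ ()
      edges′ zero    (suc j) = new-edge j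
      edges′ (suc i) zero    = mk⇔ (to (new-edge i) ∘ Adj-sym) (Adj-sym ∘ from (new-edge i))
      edges′ (suc i) (suc j) = edges b i j

      inactive′ : ∀ j {w} → Adj G (vertex c j) w → w ∈ B ∪ ⁅ v ⁆
      inactive′ zero {w} u~w with w ∈? B
      ... | yes w∈B = old w∈B
      -- The only white neighbour of `u` is `v`, so `u` becomes inactive once `v` is blue.
      ... | no  w∉B = subst (_∈ B ∪ ⁅ v ⁆) (sym (onlyWhite f w u~w w∉B)) new
      inactive′ (suc j) u~w = old (inactive b j u~w)

    stay-stay : ∀ {c c′ : TimedChain n K} → Compatible c c′ → Compatible (stay c) (stay c′)
    stay-stay cc′ = record
      { apart = apart cc′
      ; meet  = λ j j′ u~w → let x , eq , eq′ = meet cc′ j j′ u~w in suc x , eq , eq′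
      }

    grow-stay : ∀ {c c′ : TimedChain n K} → BlueChain B c′ → Compatible c c′ →
                Compatible (grow v c) (stay c′)
    grow-stay {c = c} {c′} b cc′ = record
      { apart = λ { zero    j′ eq → contradiction (subst (_∈ B) (sym eq) (isBlue b j′)) (white f)
                  ; (suc j) j′ eq → apart cc′ j j′ eq }
      ; meet  = meet′
      }
      where
      meet′ : ∀ j j′ → Adj G (vertex (grow v c) j) (vertex c′ j′) →
              ∃[ x ] (index (grow v c) x ≡ j × index (stay c′) x ≡ j′)
      -- Here `v` meets the end of the other chain at the new present; the next clause excludes
      -- edges from `v` to older vertices, which have no white neighbours.
      meet′ zero    zero     _   = zero , refl , refl
      meet′ zero    (suc j′) v~w = contradiction (inactive b j′ (Adj-sym v~w)) (white f)
      meet′ (suc j) j′       u~w = let x , eq , eq′ = meet cc′ j j′ u~w in suc x , cong suc eq , eq′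

    -- Taking the decision as an argument lets a `with` on `k ≟ i` compute the new chain.
    advance : ∀ {A : Set} → Dec A → TimedChain n K → TimedChain n (suc K)
    advance (yes _) = grow v
    advance (no _)  = stay

    step-process : ∀ {c : Fin m → TimedChain n K} → Process B c →
                   ∃[ c′ ] Process {m = m} {K = suc K} (B ∪ ⁅ v ⁆) c′
    step-process {m} {K} {c} p with covers p (blue f)
    -- The forcing vertex must end its chain, as older vertices are inactive.
    ... | i , suc j , refl = contradiction (inactive (blue-chain p i) j (adjacent f)) (white f)
    ... | i , zero , eq = c′ , record
      { blue-chain = blue-chain′
      ; compatible = compatible′
      ; covers     = covers′
      }
      where
      c′ : Fin m → TimedChain n (suc K)
      c′ k = advance (k ≟ i) (c k)

      blue-chain′ : ∀ k → BlueChain (B ∪ ⁅ v ⁆) (c′ k)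
      blue-chain′ k with k ≟ i
      ... | yes refl = grow-blue (blue-chain p k) eq
      ... | no _     = stay-blue (blue-chain p k)

      compatible′ : ∀ {k k′} → k ≢ k′ → Compatible (c′ k) (c′ k′)
      compatible′ {k} {k′} k≢k′ with k ≟ i | k′ ≟ i
      ... | yes refl | yes refl = contradiction refl k≢k′
      ... | yes _ | no _  = grow-stay (blue-chain p k′) (compatible p k≢k′)
      ... | no _  | yes _ = Compatible-sym (grow-stay (blue-chain p k) (compatible p (≢-sym k≢k′)))
      ... | no _  | no _  = stay-stay (compatible p k≢k′)

      covers-old : ∀ k j → ∃[ j′ ] vertex (c′ k) j′ ≡ vertex (c k) j
      covers-old k j with k ≟ i
      ... | yes _ = suc j , refl
      ... | no _  = j , refl

      covers-new : ∃[ j ] vertex (c′ i) j ≡ v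
      covers-new with i ≟ i
      ... | yes _  = zero , refl
      ... | no i≢i = contradiction refl i≢i

      covers′ : ∀ {w} → w ∈ B ∪ ⁅ v ⁆ → ∃₂ λ k j → vertex (c′ k) j ≡ w
      covers′ w∈ with x∈p∪q⁻ B ⁅ v ⁆ w∈
      ... | inj₂ w∈v = i , proj₁ covers-new , trans (proj₂ covers-new) (sym (x∈⁅y⁆⇒x≡y v w∈v))
      ... | inj₁ w∈B with covers p w∈B
      ... | k , j , refl = k , covers-old k j

  run : ∀ {B B′} {c : Fin m → TimedChain n K} → Star (ForcingStep G) B B′ → Process B c →
        ∃[ K′ ] Σ[ c′ ∈ (Fin m → TimedChain n K′) ] Process B′ c′
  run ε                            p = _ , _ , p
  run ((_ , _ , f , refl) ◅ steps) p = run steps (proj₂ (step-process f p))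

  process⇒family : ∀ {c : Fin m → TimedChain n K} → Process ⊤ c → InSomeFamily G m
  process⇒family {m} {K} {c} p = K , 𝒜 , φ , E′ , E′-sym , E′⇒E₂ , adjacency
    where
    𝒜 : Fin m → BlockPartition K
    𝒜 i = fibres (TimedChain.time (c i))

    name : V 𝒜 → Fin n
    name (i , j) = vertex (c i) j

    name-injective : Injective _≡_ _≡_ name
    name-injective {i , j} {i′ , j′} eq with i ≟ i′
    ... | yes refl = cong (i ,_) (distinct (blue-chain p i) eq)
    ... | no i≢i′  = contradiction eq (apart (compatible p i≢i′) j j′)

    φ : V 𝒜 ↔ Fin n
    φ = ⤖⇒↔ (mk⤖ (name-injective , λ u →
      let i , j , eq = covers p ∈⊤ in (i , j) , λ { refl → eq }))

    -- All edges of `G` between different chains; the edges within chains are exactly those of `E₁`.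
    E′ : V 𝒜 → V 𝒜 → Set
    E′ x y = proj₁ x ≢ proj₁ y × Adj G (name x) (name y)

    E′-sym : ∀ {x y} → E′ x y → E′ y x
    E′-sym (i≢i′ , x~y) = ≢-sym i≢i′ , Adj-sym x~y

    E′⇒E₂ : ∀ {x y} → E′ x y → E₂ 𝒜 x y
    E′⇒E₂ {i , j} {i′ , j′} (i≢i′ , x~y) =
      let x , eq , eq′ = meet (compatible p i≢i′) j j′ x~y
      in i≢i′ , x , x∈p∩q⁺ ( ∈-comprehension⁺ (λ x → index (c i) x ≟ j) eq
                           , ∈-comprehension⁺ (λ x → index (c i′) x ≟ j′) eq′ )

    adjacency : ∀ x y → Adj G (name x) (name y) ⇔ (E₁ 𝒜 x y ⊎ E′ x y)
    adjacency (i , j) (i′ , j′) = mk⇔ classify λ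
      { (inj₁ (refl , d))  → from (edges (blue-chain p i) j j′) d
      ; (inj₂ (_ , x~y)) → x~y }
      where
      classify : Adj G (vertex (c i) j) (vertex (c i′) j′) →
                 E₁ 𝒜 (i , j) (i′ , j′) ⊎ E′ (i , j) (i′ , j′)
      classify x~y with i ≟ i′
      ... | yes refl = inj₁ (refl , to (edges (blue-chain p i) j j′) x~y)
      ... | no i≢i′  = inj₂ (i≢i′ , x~y)

  zeroForcing⇒family : ∀ {B} → IsZeroForcingSet G B → InSomeFamily G ∣ B ∣
  zeroForcing⇒family {B} forcing = process⇒family (proj₂ (proj₂ (run forcing (initial-process B))))

corollary3p12 : ∀ {n : ℕ} (G : Graph n) →
    (∀ {K m : ℕ} (𝒜 : Fin m → BlockPartition K) (φ : V 𝒜 ↔ Fin n) →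
    InFamily 𝒜 G φ →
    let v = λ i j → Inverse.to φ (i , j)
        B = ｛ (λ i → v i zero) ｝
        C = λ i → ｛ v i ｝
    in IsZeroForcingSet G B ×
    (∃[ T ] Σ[ F ∈ (Fin T → ForceSet n) ]
    (IsRelaxedChronology G B F × IsChainSet G B F C)))
    ×
    (∃[ z ] (IsZeroForcingNumber G z × IsMinimum (InSomeFamily G) z))
corollary3p12 G = part₁ , z , isZ , family-z , family-min
  where
  part₁ = λ {K} {m} (𝒜 : Fin m → BlockPartition K) φ G∈ →
    let open FamilyMember G 𝒜 φ G∈
    in chronology⇒zeroForcing chronology , K , F , chronology , chainSet

  z   = proj₁ (zeroForcingNumber G)
  isZ = proj₂ (zeroForcingNumber G)

  family-z : InSomeFamily G z
  family-z = let B , forcing , ∣B∣≡z = proj₁ isZ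
             in subst (InSomeFamily G) ∣B∣≡z (zeroForcing⇒family G forcing)

  family-min : ∀ m → InSomeFamily G m → z ℕ.≤ m
  family-min m (K , 𝒜 , φ , G∈) =
    -- By the first part the chain starts form a zero forcing set, and there are at most `m` of
    -- them.
    ℕ.≤-trans (proj₂ isZ _ (_ , proj₁ (part₁ 𝒜 φ G∈) , refl)) (∣image∣≤ (λ i → Inverse.to φ (i , zero)))
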